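{- Let $V$ be a finite set and let $k$ be a positive integer. Let $\mathcal{F}\subseteq 2^V$ be the complement of a $k$-hierarchical lattice, and let $f:2^V\to\mathbb{Z}$ be a submodular function. Let $X^*\in\mathcal{F}$ be a minimizer of $f$ over $\mathcal{F}$. Then there exist $S,T\subseteq V$ with $S\cap T=\emptyset$ and $\max\{|S|,|T|\}\le k$ such that $X^*$ is a minimizer of $f$ over the lattice $[S,T]$.
   Context: A set function $f:2^V\to\mathbb{Z}$ is submodular if $f(X)+f(Y)\ge f(X\cup Y)+f(X\cap Y)$ for all $X,Y\subseteq V$. A family $\mathcal{H}\subseteq 2^V$ is a $k$-hierarchical lattice if there exists a chain of families $\emptyset=\mathcal{H}_0\subseteq\mathcal{H}_1\subseteq\cdots\subseteq\mathcal{H}_k=\mathcal{H}$ (where $\mathcal{H}_0$ is the empty family) such that for all $i=1,\ldots,k$ and all $X,Y\in\mathcal{H}_i\setminus\mathcal{H}_{i-1}$, either both $X\cup Y$ and $X\cap Y$ belong to $\mathcal{H}_i\setminus\mathcal{H}_{i-1}$, or at least one of $X\cup Y$, $X\cap Y$ belongs to $\mathcal{H}_{i-1}$. A family $\mathcal{F}\subseteq 2^V$ is the complement of a $k$-hierarchical lattice if $2^V\setminus\mathcal{F}$ is a $k$-hierarchical lattice. For disjoint $S,T\subseteq V$, $[S,T]:=\{X\subseteq V\mid S\subseteq X\subseteq V\setminus T\}$. A family of sets is called a lattice if it is closed under union and intersection of two members. A minimizer of $f$ over a family $\mathcal{G}\subseteq 2^V$ is a set $X\in\mathcal{G}$ with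 $f(X)\le f(Y)$ for all $Y\in\mathcal{G}$ (in particular it is a member of $\mathcal{G}$). -}

module Defs where

open import Level using (0ℓ)
open import Data.Nat as ℕ using (ℕ)
open import Data.Integer using (ℤ; _+_; _≤_; _≥_)
open import Data.Fin using (Fin; zero; suc; fromℕ; inject₁)
open import Data.Fin.Subset using (Subset; _∪_; _∩_; _⊆_; ∁)
open import Data.Fin.Subset.Properties using (x∈p∪q⁻; x∈p∩q⁺; p⊆p∪q; p∩q⊆p)
open import Data.Product using (_×_; _,_; ∃-syntax)
open import Data.Sum using (_⊎_; [_,_]′)
open import Function using (_∘_)
open import Relation.Unary as Unary using (Pred; _∈_; _≐_; _∖_)

-- The ground set V is Fin n, so Subset n is 2^V.  A family is an arbitrary
-- predicate on Subset n; membership is not required to be decidable.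
Family : ℕ → Set₁
Family n = Pred (Subset n) 0ℓ

module _ {n : ℕ} where

  Submodular : (Subset n → ℤ) → Set
  Submodular f = ∀ X Y → f X + f Y ≥ f (X ∪ Y) + f (X ∩ Y)

  -- The chain is H₀ ⊆ ⋯ ⊆ Hₖ.  As i ranges over Fin k, the pair
  -- (H (inject₁ i) , H (suc i)) ranges over (Hⱼ₋₁ , Hⱼ) for j = 1, …, k.
  record IsHierarchicalChain (k : ℕ) (H : Fin (ℕ.suc k) → Family n) : Set where
    field
      bottom   : H zero ≐ Unary.∅
      monotone : ∀ i → H (inject₁ i) Unary.⊆ H (suc i)
      closed   : ∀ i X Y →
                 X ∈ H (suc i) ∖ H (inject₁ i) →
                 Y ∈ H (suc i) ∖ H (inject₁ i) →
                 (X ∪ Y ∈ H (suc i) ∖ H (inject₁ i) ×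
                  X ∩ Y ∈ H (suc i) ∖ H (inject₁ i))
                 ⊎ (X ∪ Y ∈ H (inject₁ i) ⊎ X ∩ Y ∈ H (inject₁ i))

  HierarchicalLattice : ℕ → Family n → Set₁
  HierarchicalLattice k 𝓗 =
    ∃[ H ] (IsHierarchicalChain k H × H (fromℕ k) ≐ 𝓗)

  ComplementOfHierarchicalLattice : ℕ → Family n → Set₁
  ComplementOfHierarchicalLattice k 𝓕 = HierarchicalLattice k (Unary.∁ 𝓕)

  [_,_] : Subset n → Subset n → Family n
  [ S , T ] X = S ⊆ X × X ⊆ ∁ T

  IsLattice : Family n → Set
  IsLattice 𝓖 = ∀ X Y → X ∈ 𝓖 → Y ∈ 𝓖 → X ∪ Y ∈ 𝓖 × X ∩ Y ∈ 𝓖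

  [,]-isLattice : ∀ S T → IsLattice [ S , T ]
  [,]-isLattice S T X Y (S⊆X , X⊆∁T) (S⊆Y , Y⊆∁T) =
      (p⊆p∪q Y ∘ S⊆X , [ X⊆∁T , Y⊆∁T ]′ ∘ x∈p∪q⁻ X Y)
    , ((λ x∈S → x∈p∩q⁺ (S⊆X x∈S , S⊆Y x∈S)) , X⊆∁T ∘ p∩q⊆p X Y)

  IsMinimizer : (Subset n → ℤ) → Family n → Subset n → Set
  IsMinimizer f 𝓖 X = X ∈ 𝓖 × (∀ Y → Y ∈ 𝓖 → f X ≤ f Y)

{-# OPTIONS --safe #-}

-- A lattice that misses X* already misses all of [ S , T ] for some S ⊆ X* and T ⊆ V ∖ X* with at
-- most one element each: otherwise X* would be a union of intersections of its members.  Applied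
-- to H₁, this gives an interval around X* free of H₁.  Inside that interval no union or
-- intersection can fall into H₁, so the restriction of H₂ is a lattice and the argument repeats.
-- After k rounds [ S , T ] contains no member of the complement of 𝓕.
--
-- Families need not be decidable, so the intervals are only found under a double negation.  It is
-- removed at the end, since the conclusion quantifies over finitely many sets and is decidable.

module Submission where

open import Defs
open import Data.Bool.Properties as Bool using ()
open import Data.Fin using (Fin; zero; suc; fromℕ; inject₁; toℕ)
open import Data.Fin.Induction using (<-weakInduction; >-weakInduction)
open import Data.Fin.Properties using (toℕ-fromℕ; toℕ-inject₁)
open import Data.Nat using (ℕ; NonZero; _⊔_; _≤_; _+_; z≤n; s≤s)
open import Data.Nat.Properties as ℕ using ()
open import Data.Integer as ℤ using (ℤ)
open import Data.Integer.Properties as ℤ using ()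
open import Data.Fin.Subset using (Subset; _∈_; _⊆_; _∪_; _∩_; ∁; ⊥; ⁅_⁆; ∣_∣; inside; outside)
open import Data.Fin.Subset.Properties
open import Algebra.Lattice.Properties.BooleanAlgebra as BooleanAlgebra using ()
open import Data.List using (List; []; _∷_; allFin)
open import Data.List.Membership.Propositional using () renaming (_∈_ to _∈ₗ_)
open import Data.List.Membership.Propositional.Properties using (∈-allFin)
open import Data.List.Relation.Unary.Any using (here; there)
open import Data.Product using (_×_; _,_; ∃-syntax; proj₁; proj₂)
open import Data.Sum using (inj₁; inj₂)
open import Data.Vec using ([]; _∷_)
open import Data.Vec.Properties using (≡-dec)
open import Function using (_∘_)
open import Relation.Binary.PropositionalEquality using (_≡_; refl; sym; subst)
open import Relation.Nullary using (¬_; Dec; yes; no; contradiction)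
open import Relation.Nullary.Decidable using (map′; ¬?; _×-dec_; _→-dec_; decidable-stable)
open import Relation.Nullary.Negation using (¬¬-map; ∀⟶¬∃¬)
open import Relation.Unary as Unary using (Decidable)

∣p∪q∣≤∣p∣+∣q∣ : ∀ {n} (p q : Subset n) → ∣ p ∪ q ∣ ≤ ∣ p ∣ + ∣ q ∣
∣p∪q∣≤∣p∣+∣q∣ []            []            = z≤n
∣p∪q∣≤∣p∣+∣q∣ (inside  ∷ p) (inside  ∷ q) =
  s≤s (ℕ.≤-trans (∣p∪q∣≤∣p∣+∣q∣ p q) (ℕ.+-monoʳ-≤ ∣ p ∣ (ℕ.n≤1+n ∣ q ∣)))
∣p∪q∣≤∣p∣+∣q∣ (inside  ∷ p) (outside ∷ q) = s≤s (∣p∪q∣≤∣p∣+∣q∣ p q)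
∣p∪q∣≤∣p∣+∣q∣ (outside ∷ p) (inside  ∷ q) =
  subst (ℕ.suc ∣ p ∪ q ∣ ≤_) (sym (ℕ.+-suc ∣ p ∣ ∣ q ∣)) (s≤s (∣p∪q∣≤∣p∣+∣q∣ p q))
∣p∪q∣≤∣p∣+∣q∣ (outside ∷ p) (outside ∷ q) = ∣p∪q∣≤∣p∣+∣q∣ p q

allSubset? : ∀ {n ℓ} {P : Subset n → Set ℓ} → Decidable P → Dec (∀ Y → P Y)
allSubset? P? = map′
  (λ ¬∃¬ Y → decidable-stable (P? Y) (λ ¬PY → ¬∃¬ (Y , ¬PY)))
  ∀⟶¬∃¬
  (¬? (anySubset? (¬? ∘ P?)))

module _ {n : ℕ} where

  open BooleanAlgebra (∪-∩-booleanAlgebra n)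
    using () renaming (deMorgan₁ to ∁-∪; deMorgan₂ to ∁-∩; ¬-involutive to ∁-involutive)

  ∪⊆ : ∀ {S T X : Subset n} → S ⊆ X → T ⊆ X → S ∪ T ⊆ X
  ∪⊆ {S} {T} S⊆X T⊆X x∈S∪T with x∈p∪q⁻ S T x∈S∪T
  ... | inj₁ x∈S = S⊆X x∈S
  ... | inj₂ x∈T = T⊆X x∈T

  -- Both inclusions say that `X` and `T` are disjoint. The form `T ⊆ ∁ X` lets upper bounds of an
  -- interval be combined by `∪⊆`.
  ⊆∁-sym : ∀ {X T : Subset n} → X ⊆ ∁ T → T ⊆ ∁ X
  ⊆∁-sym X⊆∁T x∈T = x∉p⇒x∈∁p (λ x∈X → x∈∁p⇒x∉p (X⊆∁T x∈X) x∈T)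

  -- Members covering the single elements of `X` are joined one after another. Only finitely many
  -- choices occur, so they can be made one by one under the double negation.
  ∪-closed⇒member⊇ : ∀ (N : Family n) X →
    (∀ A B → N A → N B → N (A ∪ B)) →
    (∀ S → S ⊆ X → ∣ S ∣ ≤ 1 → ¬ ¬ (∃[ Y ] (N Y × S ⊆ Y))) →
    ¬ ¬ (∃[ Y ] (N Y × X ⊆ Y))
  ∪-closed⇒member⊇ N X closed small =
    ¬¬-map (λ (Y , NY , cover) → Y , NY , λ {x} → cover x (∈-allFin x)) (go (allFin n))
    where
    go : ∀ xs → ¬ ¬ (∃[ Y ] (N Y × (∀ x → x ∈ₗ xs → x ∈ X → x ∈ Y)))
    -- Nothing is to be covered yet, but some member is needed to start from. The case `S = ⊥`
    -- supplies it, which is why the bound is `≤ 1` and not `≡ 1`.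
    go [] = ¬¬-map (λ (Y , NY , _) → Y , NY , λ _ ())
      (small ⊥ ⊥⊆ (subst (_≤ 1) (sym (∣⊥∣≡0 n)) z≤n))
    go (x ∷ xs) with x ∈? X
    ... | no x∉X = ¬¬-map
      (λ (Y , NY , cover) → Y , NY , λ where
        _ (here refl) x∈X → contradiction x∈X x∉X
        y (there y∈xs)    → cover y y∈xs)
      (go xs)
    ... | yes x∈X = λ k → go xs λ (Y , NY , cover) →
      small ⁅ x ⁆ (λ y∈⁅x⁆ → subst (_∈ X) (sym (x∈⁅y⁆⇒x≡y x y∈⁅x⁆)) x∈X)
            (ℕ.≤-reflexive (∣⁅x⁆∣≡1 x)) λ (Z , NZ , ⁅x⁆⊆Z) →
      k (Y ∪ Z , closed Y Z NY NZ , λ where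
        _ (here refl) _    → q⊆p∪q Y Z (⁅x⁆⊆Z (x∈⁅x⁆ x))
        y (there y∈xs) y∈X → p⊆p∪q Z (cover y y∈xs y∈X))

  -- Dual of the previous lemma: by De Morgan the complements of members form a family closed under
  -- union, and containing `∁ X` becomes lying inside `X`.
  ∩-closed⇒member⊆ : ∀ (N : Family n) X →
    (∀ A B → N A → N B → N (A ∩ B)) →
    (∀ T → X ⊆ ∁ T → ∣ T ∣ ≤ 1 → ¬ ¬ (∃[ Y ] (N Y × Y ⊆ ∁ T))) →
    ¬ ¬ (∃[ Y ] (N Y × Y ⊆ X))
  ∩-closed⇒member⊆ N X closed small =
    λ k → ∪-closed⇒member⊇ (N ∘ ∁) (∁ X)
      (λ A B NA NB → subst N (sym (∁-∩ A B)) (closed (∁ A) (∁ B) NA NB))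
      (λ T T⊆∁X ∣T∣≤1 k′ → small T (⊆∁-sym T⊆∁X) ∣T∣≤1 λ (Y , NY , Y⊆∁T) →
        k′ (∁ Y , subst N (sym (∁-involutive Y)) NY , ⊆∁-sym Y⊆∁T))
      (λ (Y , NY , ∁X⊆Y) → k (∁ Y , NY , subst (∁ Y ⊆_) (∁-involutive X) (p⊆q⇒∁p⊇∁q ∁X⊆Y)))

  Separated : ℕ → Family n → Subset n → Set
  Separated m M X =
    ∃[ S ] ∃[ T ] (X Unary.∈ [ S , T ] × ∣ S ∣ ≤ m × ∣ T ∣ ≤ m × (∀ Y → Y Unary.∈ [ S , T ] → ¬ M Y))

  -- If no pair separates, then for each small `S ⊆ X` the members containing `S` intersect to one
  -- between `S` and `X`. The union of these over all `S` is a member equal to `X`.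
  lattice-separated : ∀ (M : Family n) X → IsLattice M → ¬ M X → ¬ ¬ Separated 1 M X
  lattice-separated M X lattice X∉M ¬sep =
    ∪-closed⇒member⊇ (λ Y → M Y × Y ⊆ X) X
      (λ A B (MA , A⊆X) (MB , B⊆X) → proj₁ (lattice A B MA MB) , ∪⊆ A⊆X B⊆X)
      (λ S S⊆X ∣S∣≤1 k → ∩-closed⇒member⊆ (λ Y → M Y × S ⊆ Y) X
        (λ A B (MA , S⊆A) (MB , S⊆B) →
          proj₂ (lattice A B MA MB) , λ x∈S → x∈p∩q⁺ (S⊆A x∈S , S⊆B x∈S))
        (λ T X⊆∁T ∣T∣≤1 none → ¬sep (S , T , (S⊆X , X⊆∁T) , ∣S∣≤1 , ∣T∣≤1 ,
          λ Y (S⊆Y , Y⊆∁T) MY → none (Y , (MY , S⊆Y) , Y⊆∁T)))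
        (λ (Y , (MY , S⊆Y) , Y⊆X) → k (Y , (MY , Y⊆X) , S⊆Y)))
      (λ (Y , (MY , Y⊆X) , X⊆Y) → X∉M (subst M (⊆-antisym Y⊆X X⊆Y) MY))

  chain-separated : ∀ k {H : Fin (ℕ.suc k) → Family n} → IsHierarchicalChain k H →
    ∀ X → ¬ H (fromℕ k) X → ∀ i → ¬ ¬ Separated (toℕ i) (H i) X
  chain-separated k {H} chain X X∉Hₖ =
    <-weakInduction (λ i → ¬ ¬ Separated (toℕ i) (H i) X) base step
    where
    open IsHierarchicalChain chain

    X∉H : ∀ i → ¬ H i X
    -- Avoiding the top family passes down the chain by monotonicity.
    X∉H = >-weakInduction (λ i → ¬ H i X) X∉Hₖ (λ i X∉Hᵢ₊₁ → X∉Hᵢ₊₁ ∘ monotone i)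

    base : ¬ ¬ Separated 0 (H zero) X
    base ¬sep = ¬sep (⊥ , ⊥ , (⊥⊆ , ⊆∁-sym ⊥⊆) ,
      ℕ.≤-reflexive (∣⊥∣≡0 n) , ℕ.≤-reflexive (∣⊥∣≡0 n) , λ _ _ → proj₁ bottom)

    ∣∪∣≤ : ∀ {m} (P Q : Subset n) → ∣ P ∣ ≤ m → ∣ Q ∣ ≤ 1 → ∣ P ∪ Q ∣ ≤ ℕ.suc m
    ∣∪∣≤ {m} P Q ∣P∣≤m ∣Q∣≤1 = ℕ.≤-trans (∣p∪q∣≤∣p∣+∣q∣ P Q)
      (subst (∣ P ∣ + ∣ Q ∣ ≤_) (ℕ.+-comm m 1) (ℕ.+-mono-≤ ∣P∣≤m ∣Q∣≤1))

    lattice : ∀ i S T → (∀ Y → Y Unary.∈ [ S , T ] → ¬ H (inject₁ i) Y) →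
              IsLattice (H (suc i) Unary.∩ [ S , T ])
    lattice i S T free A B (HA , A∈) (HB , B∈)
      with [,]-isLattice S T A B A∈ B∈
         | closed i A B (HA , free A A∈) (HB , free B B∈)
    ... | ∪∈ , ∩∈ | inj₁ ((H∪ , _) , (H∩ , _)) = (H∪ , ∪∈) , (H∩ , ∩∈)
    -- The interval is itself a lattice, so this set would lie in it and in `H (inject₁ i)`.
    ... | ∪∈ , ∩∈ | inj₂ (inj₁ H∪) = contradiction H∪ (free (A ∪ B) ∪∈)
    ... | ∪∈ , ∩∈ | inj₂ (inj₂ H∩) = contradiction H∩ (free (A ∩ B) ∩∈)

    step : ∀ i → ¬ ¬ Separated (toℕ (inject₁ i)) (H (inject₁ i)) X →
           ¬ ¬ Separated (toℕ (suc i)) (H (suc i)) X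
    step i sep ¬sep = sep λ (S , T , (S⊆X , X⊆∁T) , ∣S∣≤ , ∣T∣≤ , free) →
      lattice-separated _ X (lattice i S T free) (X∉H (suc i) ∘ proj₁)
        λ (S′ , T′ , (S′⊆X , X⊆∁T′) , ∣S′∣≤1 , ∣T′∣≤1 , free′) →
      -- The new interval is the intersection of `[ S , T ]` and `[ S′ , T′ ]`; each bound grows by
      -- at most one element.
      ¬sep (S ∪ S′ , T ∪ T′ ,
        (∪⊆ S⊆X S′⊆X , ⊆∁-sym (∪⊆ (⊆∁-sym X⊆∁T) (⊆∁-sym X⊆∁T′))) ,
        ∣∪∣≤ S S′ (subst (_ ≤_) (toℕ-inject₁ i) ∣S∣≤) ∣S′∣≤1 ,
        ∣∪∣≤ T T′ (subst (_ ≤_) (toℕ-inject₁ i) ∣T∣≤) ∣T′∣≤1 ,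
        λ Y (S∪S′⊆Y , Y⊆∁T∪T′) HY → free′ Y
          ( S∪S′⊆Y ∘ q⊆p∪q S S′
          , ⊆∁-sym (⊆∁-sym Y⊆∁T∪T′ ∘ q⊆p∪q T T′))
          (HY , S∪S′⊆Y ∘ p⊆p∪q S′ , ⊆∁-sym (⊆∁-sym Y⊆∁T∪T′ ∘ p⊆p∪q T′)))

  [,]-nonempty⇒disjoint : ∀ (S T X : Subset n) → X Unary.∈ [ S , T ] → S ∩ T ≡ ⊥
  [,]-nonempty⇒disjoint S T X (S⊆X , X⊆∁T) = Empty-unique λ (x , x∈S∩T) →
    let (x∈S , x∈T) = x∈p∩q⁻ S T x∈S∩T in x∈∁p⇒x∉p (X⊆∁T (S⊆X x∈S)) x∈T

  [,]? : ∀ (S T : Subset n) → Decidable [ S , T ]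
  [,]? S T X = S ⊆? X ×-dec X ⊆? ∁ T

  isMinimizer? : ∀ f (𝓖 : Family n) → Decidable 𝓖 → Decidable (IsMinimizer f 𝓖)
  isMinimizer? f 𝓖 𝓖? X = 𝓖? X ×-dec allSubset? (λ Y → 𝓖? Y →-dec (f X ℤ.≤? f Y))

theorem2p1 : ∀ (n k : ℕ) .{{_ : NonZero k}} (𝓕 : Family n) (f : Subset n → ℤ) (X* : Subset n) →
    ComplementOfHierarchicalLattice k 𝓕 →
    Submodular f →
    IsMinimizer f 𝓕 X* →
    ∃[ S ] ∃[ T ] (S ∩ T ≡ ⊥ × ∣ S ∣ ⊔ ∣ T ∣ ≤ k × IsMinimizer f [ S , T ] X*)
theorem2p1 n k 𝓕 f X* (H , chain , Hₖ⊆∁𝓕 , ∁𝓕⊆Hₖ) _ (X*∈𝓕 , X*-min) =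
  decidable-stable
    (anySubset? λ S → anySubset? λ T →
      ≡-dec Bool._≟_ (S ∩ T) ⊥ ×-dec (∣ S ∣ ⊔ ∣ T ∣ ℕ.≤? k) ×-dec isMinimizer? f [ S , T ] ([,]? S T) X*)
    (¬¬-map
      (λ (S , T , X*∈ , ∣S∣≤ , ∣T∣≤ , free) → S , T ,
        [,]-nonempty⇒disjoint S T X* X*∈ ,
        subst (_ ≤_) (toℕ-fromℕ k) (ℕ.⊔-lub ∣S∣≤ ∣T∣≤) ,
        -- If `f X* ≤ f Y` failed, minimality would put `Y` outside `𝓕`, hence in `H (fromℕ k)`,
        -- which the interval avoids. Only the comparison of integers has to be decidable here.
        X*∈ , λ Y Y∈ → decidable-stable (f X* ℤ.≤? f Y)
          (λ fX*≰fY → free Y Y∈ (∁𝓕⊆Hₖ (fX*≰fY ∘ X*-min Y))))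
      (chain-separated k chain X* (λ X*∈Hₖ → Hₖ⊆∁𝓕 X*∈Hₖ X*∈𝓕) (fromℕ k)))
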